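{- Let $p$ be a prime, $q=p^\lambda$ with $\lambda\ge1$, and let $F$ be a field with $\mathbb F_q\subseteq F$. Then $\mathfrak{BD}^\ast_{q,0}\subseteq\mathfrak{BD}^\ast$ is an $\mathbb F_p$-subspace of $\mathfrak{BD}^\ast$.
   Context: $F[x]\{\{\mathfrak D\}\}$ is the commutative ring of formal series $\sum_{i\ge0}a_i\mathfrak D_i$ ($a_i\in F[x]$) with coefficientwise addition and multiplication $(\sum_i a_i\mathfrak D_i)(\sum_j b_j\mathfrak D_j)=\sum_n\big(\sum_{i=0}^n\binom ni a_ib_{n-i}\big)\mathfrak D_n$; its unit is $\mathfrak D_0=1$. A sequence $P=\{p_i(x)\}_{i=0}^\infty$ in $F[x]$ satisfies the Binomial Theorem if $p_n(x+y)=\sum_{i=0}^n \binom{n}{i}p_i(x)p_{n-i}(y)$ for all $n\ge 0$; it is nontrivial if not all $p_i(x)$ are zero. Its generating function is $f_P(x)=\sum_{i\ge0}p_i(x)\mathfrak D_i$. $\mathfrak{BD}^\ast$ is the set of generating functions of nontrivial sequences satisfying the Binomial Theorem; it is an abelian group under multiplication in which every element satisfies $f^p=1$, and it is thus regarded as an $\mathbb F_p$-vector space, with vector addition being multiplication of series and scalar multiplication $(n\bmod p)\cdot f=f^n$. A polynomial in $F[x]$ is $\mathbb F_q$-linear if it is a finite $F$-linear combination of monomials $x^{q^n}$, $n\ge0$; $\mathfrak L_q$ is the set of sequences $E=\{e_t(x)\}_{t=0}^\infty$ of $\mathbb F_q$-linear polynomials. For $E\in\mathfrak L_q$ and $i=\sum_t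 i_tq^t$ ($0\le i_t<q$) put $p_{E,i}(x):=\prod_t e_t(x)^{i_t}$ (with $e^0=1$) and $P_E:=\{p_{E,i}(x)\}_{i=0}^\infty$. Then $\mathfrak{BD}^\ast_{q,0}:=\{f_{P_E}(x):E\in\mathfrak L_q\}$. -}

module Defs where

open import Algebra.Apartness.Bundles using (HeytingCommutativeRing; HeytingField)
open import Algebra.Bundles using (CommutativeRing)
open import Algebra.Bundles.Raw using (RawRing)
import Algebra.Definitions.RawSemiring as RawSemiringDefs
open import Data.Fin.Base using (Fin; toℕ)
open import Data.List.Base using (List; []; _∷_; map; foldr)
open import Data.Nat.Base as ℕ using (ℕ; zero; suc; _∸_; NonZero)
open import Data.Nat.Combinatorics using (_C_)
open import Data.Nat.DivMod using (_/_; _%_)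
open import Data.Product.Base using (Σ; ∃-syntax; _×_)
open import Function.Bundles using (Inverse)
open import Level using (Level; _⊔_)
open import Relation.Binary.Bundles using (Setoid)
open import Relation.Binary.PropositionalEquality as ≡ using ()
open import Relation.Nullary.Negation using (¬_)
open import Relation.Unary using (Pred; _∈_; _⊆_)

private
  variable
    c ℓ ℓ₁ ℓ₂ : Level

fieldSetoid : HeytingField c ℓ₁ ℓ₂ → Setoid c ℓ₁
fieldSetoid K = CommutativeRing.setoid
  (HeytingCommutativeRing.commutativeRing (HeytingField.heytingCommutativeRing K))

fieldRawRing : HeytingField c ℓ₁ ℓ₂ → RawRing c ℓ₁
fieldRawRing K = CommutativeRing.rawRing
  (HeytingCommutativeRing.commutativeRing (HeytingField.heytingCommutativeRing K))

HasOrder : HeytingField c ℓ₁ ℓ₂ → ℕ → Set (c ⊔ ℓ₁)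
HasOrder K q = Inverse (fieldSetoid K) (≡.setoid (Fin q))

-- R[x]: coefficient lists, constant term first.  Trailing zeros are allowed,
-- so equality compares coefficients.
module _ (R : RawRing c ℓ) where
  open RawRing R

  coeff : List Carrier → ℕ → Carrier
  coeff []      _       = 0#
  coeff (a ∷ f) zero    = a
  coeff (a ∷ f) (suc n) = coeff f n

  addPoly : List Carrier → List Carrier → List Carrier
  addPoly []      g       = g
  addPoly (a ∷ f) []      = a ∷ f
  addPoly (a ∷ f) (b ∷ g) = (a + b) ∷ addPoly f g

  mulPoly : List Carrier → List Carrier → List Carrier
  mulPoly []      g = []
  mulPoly (a ∷ f) g = addPoly (map (a *_) g) (0# ∷ mulPoly f g)

  polynomialRing : RawRing c ℓ
  polynomialRing = record
    { Carrier = List Carrier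
    ; _≈_     = λ f g → ∀ n → coeff f n ≈ coeff g n
    ; _+_     = addPoly
    ; _*_     = mulPoly
    ; -_      = map (-_)
    ; 0#      = []
    ; 1#      = 1# ∷ []
    }

  const : Carrier → List Carrier
  const a = a ∷ []

  X : List Carrier
  X = 0# ∷ 1# ∷ []

-- R{{𝔇}}: the series Σ aᵢ 𝔇ᵢ is represented by its coefficient sequence a.
module _ (R : RawRing c ℓ) where
  open RawRing R
  open RawSemiringDefs rawSemiring using (sum) renaming (_×_ to _·_)

  mulSeries : (ℕ → Carrier) → (ℕ → Carrier) → (ℕ → Carrier)
  mulSeries a b n =
    sum {suc n} λ i → (n C toℕ i) · (a (toℕ i) * b (n ∸ toℕ i))

  oneSeries : ℕ → Carrier
  oneSeries zero    = 1#
  oneSeries (suc _) = 0#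

  seriesRing : RawRing c ℓ
  seriesRing = record
    { Carrier = ℕ → Carrier
    ; _≈_     = λ a b → ∀ n → a n ≈ b n
    ; _+_     = λ a b n → a n + b n
    ; _*_     = mulSeries
    ; -_      = λ a n → - a n
    ; 0#      = λ _ → 0#
    ; 1#      = oneSeries
    }

digit : (q : ℕ) .{{_ : NonZero q}} → ℕ → ℕ → ℕ
digit q i zero    = i % q
digit q i (suc t) = digit q (i / q) t

module _ (F : HeytingField c ℓ₁ ℓ₂) where

  private
    F₀ = fieldRawRing F

  F[x] : RawRing c ℓ₁
  F[x] = polynomialRing F₀

  -- F[x,y] as F[x][y].
  F[x,y] : RawRing c ℓ₁
  F[x,y] = polynomialRing F[x]

  F[x]⟪𝔇⟫ : RawRing c ℓ₁
  F[x]⟪𝔇⟫ = seriesRing F[x]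

  private
    module F    = RawRing F₀
    module P    = RawRing F[x]
    module P²   = RawRing F[x,y]
    module S    = RawRing F[x]⟪𝔇⟫
    module P-S  = RawSemiringDefs P.rawSemiring
    module P²-S = RawSemiringDefs P².rawSemiring
    module S-S  = RawSemiringDefs S.rawSemiring

  varX varY : P².Carrier
  varX = const F[x] (X F₀)
  varY = X F[x]

  infix 9 _⟨_⟩
  _⟨_⟩ : P.Carrier → P².Carrier → P².Carrier
  f ⟨ s ⟩ = foldr (λ a r → const F[x] (const F₀ a) P².+ s P².* r) P².0# f

  SatisfiesBinomialTheorem : (ℕ → P.Carrier) → Set ℓ₁
  SatisfiesBinomialTheorem p = ∀ n →
    p n ⟨ varX P².+ varY ⟩ P².≈
      P²-S.sum {suc n} λ i →
        (n C toℕ i) P²-S.× (p (toℕ i) ⟨ varX ⟩ P².* p (n ∸ toℕ i) ⟨ varY ⟩)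

  Nontrivial : (ℕ → P.Carrier) → Set ℓ₁
  Nontrivial p = ¬ (∀ i → p i P.≈ P.0#)

  generatingFunction : (ℕ → P.Carrier) → S.Carrier
  generatingFunction p = p

  𝔅𝔇* : Pred S.Carrier (c ⊔ ℓ₁)
  𝔅𝔇* f = ∃[ p ] (SatisfiesBinomialTheorem p × Nontrivial p × f S.≈ generatingFunction p)

  IsLinear : ℕ → P.Carrier → Set (c ⊔ ℓ₁)
  IsLinear q f = ∃[ m ] Σ (Fin m → F.Carrier) λ a →
    f P.≈ P-S.sum λ n → const F₀ (a n) P.* X F₀ P-S.^ (q ℕ.^ toℕ n)

  𝔏 : ℕ → Pred (ℕ → P.Carrier) (c ⊔ ℓ₁)
  𝔏 q e = ∀ t → IsLinear q (e t)

  -- For q ≥ 2 we have i < q ^ i, so the base-q digits of i in positions t ≥ i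
  -- vanish and the product may be cut off at t < i.
  digitProducts : (q : ℕ) .{{_ : NonZero q}} → (ℕ → P.Carrier) → ℕ → P.Carrier
  digitProducts q e i = P-S.product {i} λ t → e (toℕ t) P-S.^ digit q i (toℕ t)

  𝔅𝔇*₀ : (q : ℕ) .{{_ : NonZero q}} → Pred S.Carrier (c ⊔ ℓ₁)
  𝔅𝔇*₀ q f = ∃[ e ] (e ∈ 𝔏 q × f S.≈ generatingFunction (digitProducts q e))

  -- Subspaces for the multiplicatively written 𝔽ₚ-vector space structure:
  -- vector addition is the product of series, the zero vector is 𝔇₀, and the
  -- scalar n mod p, represented by n : Fin p, acts by f ↦ f ^ n.
  record IsSubspace {ℓ ℓ′} (p : ℕ) (W : Pred S.Carrier ℓ) (V : Pred S.Carrier ℓ′)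
         : Set (c ⊔ ℓ ⊔ ℓ′) where
    field
      W⊆V         : W ⊆ V
      zero-closed : S.1# ∈ W
      add-closed  : ∀ {f g} → f ∈ W → g ∈ W → f S.* g ∈ W
      smul-closed : ∀ (n : Fin p) {f} → f ∈ W → f S-S.^ toℕ n ∈ W

{-# OPTIONS --safe #-}
module Submission where

-- Everything rests on one identity in a commutative ring of characteristic p,
--   Σᵢ (n C i) D a i D b (n ∸ i) = D (a + b) n,   D a n = ∏ₜ aₜ ^ (t-th base-q digit of n).
-- In F[x] it says that P_E and P_E′ multiply to P_{E+E′}; in F[x,y], applied to
-- aₜ = eₜ(x) and bₜ = eₜ(y), it is the Binomial Theorem, as eₜ(x + y) = eₜ(x) + eₜ(y).
-- It replaces Lucas' theorem: the shift ∂ of series is a derivation, so in characteristic p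
-- its power ∂^q is one as well, and induction on n peels off the last digit.

open import Defs
open import Algebra.Apartness.Bundles using (HeytingCommutativeRing; HeytingField)
open import Algebra.Bundles using (CommutativeRing)
open import Algebra.Bundles.Raw using (RawRing)
import Algebra.Morphism.Construct.Composition as Composition
open import Algebra.Morphism.Structures using (module RingMorphisms; module SemiringMorphisms)
open import Data.Fin.Base using (Fin; toℕ) renaming (zero to fzero; suc to fsuc)
open import Data.Fin.Permutation using (Permutation; permutation)
import Data.Fin.Properties as Fin
open import Data.List.Base using (List; []; _∷_; map; foldr)
open import Data.Nat.Base as ℕ
  using (ℕ; zero; suc; _≤_; _<_; _^_; _∸_; _!; NonZero; z≤n; s≤s; z<s)
open import Data.Nat.Combinatorics
  using (_C_; nCk≡n!/k![n-k]!; k![n∸k]!∣n!; k>n⇒nCk≡0; nCn≡1; nCk≡nC[n∸k]; nCk+nC[k+1]≡[n+1]C[k+1])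
open import Data.Nat.Divisibility using (_∣_; divides; ∣⇒≤; m∣m*n)
open import Data.Nat.DivMod
open import Data.Nat.Primality using (Prime; euclidsLemma; prime⇒nonZero; prime⇒nonTrivial)
import Data.Nat.Properties as ℕ
open import Data.Product.Base using (Σ; ∃-syntax; _,_; proj₁; proj₂)
open import Data.Sum.Base using (inj₁; inj₂)
open import Data.Vec.Functional using () renaming (_∷_ to _∷ᵛ_)
open import Function.Base using (_∘_; _$_)
open import Function.Bundles using (Inverse)
open import Level using (Level)
open import Relation.Binary.PropositionalEquality as ≡ using (_≡_)
import Relation.Binary.Reasoning.Setoid as SetoidReasoning
open import Relation.Nullary.Negation using (¬_; contradiction)
open import Relation.Unary using (_∈_)

-- In the definition of the series the number of factors grows with the index, while an induction on
-- digits needs one number of factors for all indices of a sum. Hence `digitProduct` takes a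
-- separate length `N`, and the bound `i < q ^ i` ties it back to the series. The characteristic of
-- `F` is not given either: it has to be extracted from the finite subfield, whose order annihilates
-- 1.

private
  variable
    c ℓ c′ ℓ′ ℓ₁ ℓ₂ ℓ₁′ ℓ₂′ : Level

-- Binomial coefficients modulo a prime, and division with remainder

prime∤! : ∀ {p n} → Prime p → n < p → ¬ p ∣ n !
prime∤! {p} {zero} pr _ p∣1 =
  ℕ.<⇒≱ (ℕ.nonTrivial⇒n>1 p {{prime⇒nonTrivial pr}}) (∣⇒≤ p∣1)
prime∤! {p} {suc n} pr 1+n<p p∣ with euclidsLemma (suc n) (n !) pr p∣
... | inj₁ p∣1+n = ℕ.<⇒≱ 1+n<p (∣⇒≤ p∣1+n)
... | inj₂ p∣n!  = prime∤! pr (ℕ.<-trans (ℕ.n<1+n n) 1+n<p) p∣n!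

n!≡nCk*k![n∸k]! : ∀ {n k} → k ≤ n → n ! ≡ (n C k) ℕ.* (k ! ℕ.* (n ∸ k) !)
n!≡nCk*k![n∸k]! {n} {k} k≤n = ≡.sym (≡.trans
  (≡.cong (ℕ._* (k ! ℕ.* (n ∸ k) !)) (nCk≡n!/k![n-k]! k≤n))
  (m/n*n≡m (k![n∸k]!∣n! k≤n)))
  where instance _ = k ℕ.!* (n ∸ k) !≢0

p∣p! : ∀ p .{{_ : NonZero p}} → p ∣ p !
p∣p! (suc n) = m∣m*n (n !)

-- `p` divides `p !`, the product of `p C k` with two factorials of numbers below `p`; being prime,
-- it divides neither factorial.
prime∣C : ∀ {p k} → Prime p → 0 < k → k < p → p ∣ p C k
prime∣C {p} {k} pr 0<k k<p
  with euclidsLemma (p C k) _ pr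
         (≡.subst (p ∣_) (n!≡nCk*k![n∸k]! (ℕ.<⇒≤ k<p)) (p∣p! p {{prime⇒nonZero pr}}))
... | inj₁ p∣C = p∣C
... | inj₂ p∣k![p∸k]! with euclidsLemma (k !) _ pr p∣k![p∸k]!
...   | inj₁ p∣k!     = contradiction p∣k! (prime∤! pr k<p)
...   | inj₂ p∣[p∸k]! = contradiction p∣[p∸k]! (prime∤! pr (ℕ.∸-monoʳ-< 0<k (ℕ.<⇒≤ k<p)))

nC0≡1 : ∀ n → n C 0 ≡ 1
nC0≡1 n = ≡.trans (nCk≡nC[n∸k] {0} {n} z≤n) (nCn≡1 n)

[r+mq]/q≡m : ∀ {r} m q .{{_ : NonZero q}} → r < q → (r ℕ.+ m ℕ.* q) / q ≡ m
[r+mq]/q≡m {r} m q r<q = ≡.trans (+-distrib-/-∣ʳ r (divides m ≡.refl))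
  (≡.cong₂ ℕ._+_ (m<n⇒m/n≡0 r<q) (m*n/n≡m m q))

[r+mq]%q≡r : ∀ {r} m q .{{_ : NonZero q}} → r < q → (r ℕ.+ m ℕ.* q) % q ≡ r
[r+mq]%q≡r {r} m q r<q = ≡.trans ([m+kn]%n≡m%n r m q) (m<n⇒m%n≡m r<q)

m<q^1+N⇒m/q<q^N : ∀ {m q} N .{{_ : NonZero q}} → m < q ^ suc N → m / q < q ^ N
m<q^1+N⇒m/q<q^N {m} {q} N m<q^ = m<n*o⇒m/o<n (≡.subst (m <_) (ℕ.*-comm q (q ^ N)) m<q^)

-- Justifies the cut-off of the digit product: the base-`m` digits of `n` from position `n` on are
-- 0.
n<m^n : ∀ {m} n → 1 < m → n < m ^ n
n<m^n zero 1<m = z<s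
n<m^n {m} (suc n) 1<m = ℕ.≤-<-trans (n<m^n n 1<m) (ℕ.^-monoʳ-< m 1<m (ℕ.n<1+n n))

-- Says only that `n` annihilates the unit, not that the characteristic is exactly `n`; in this form
-- it passes along every homomorphism.
_≈0In_ : ℕ → CommutativeRing c ℓ → Set ℓ
n ≈0In R = n × 1# ≈ 0#
  where
  open CommutativeRing R
  open import Algebra.Properties.Semiring.Mult semiring using (_×_)

-- Binomial sums and the Frobenius map in a commutative ring

module BinomialSums (R : CommutativeRing c ℓ) where
  open CommutativeRing R hiding (zero)
  open import Algebra.Properties.CommutativeSemiring.Exp commutativeSemiring
    using (^-congˡ) renaming (_^_ to _^ᴿ_)
  open import Algebra.Properties.CommutativeMonoid.Sum +-commutativeMonoid
    using (sum; sum-cong-≋; ∑-distrib-+; sum-replicate-zero)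
  open import Algebra.Properties.Semiring.Mult semiring
  open import Algebra.Properties.CommutativeSemigroup *-commutativeSemigroup
    using (interchange; x∙yz≈y∙xz)
  open import Algebra.Properties.CommutativeMonoid.Sum *-commutativeMonoid
    using () renaming (sum to product; sum-cong-≋ to product-cong)
  open SetoidReasoning setoid

  -- The sum Σᵢ (n C i) h i (n ∸ i), unfolded by Pascal's rule.
  binomialSum : ℕ → (ℕ → ℕ → Carrier) → Carrier
  binomialSum zero    h = h 0 0
  binomialSum (suc n) h =
    binomialSum n (λ i j → h (suc i) j) + binomialSum n (λ i j → h i (suc j))

  -- Only index pairs with sum `n` occur. The constraint is what later bounds both indices by a
  -- digit `r < q`, or by the length of a product.
  binomialSum-cong : ∀ n {g h} → (∀ i j → i ℕ.+ j ≡ n → g i j ≈ h i j) →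
                     binomialSum n g ≈ binomialSum n h
  binomialSum-cong zero    g≈h = g≈h 0 0 ≡.refl
  binomialSum-cong (suc n) g≈h = +-cong
    (binomialSum-cong n λ i j eq → g≈h (suc i) j (≡.cong suc eq))
    (binomialSum-cong n λ i j eq → g≈h i (suc j) (≡.trans (ℕ.+-suc i j) (≡.cong suc eq)))

  -- `binomialSum n` applies the `n`-th power of the sum of the two index shifts and reads off the
  -- value at `(0 , 0)`. This is the power law for that operator, a form of Vandermonde's identity.
  binomialSum-+ : ∀ m n h →
    binomialSum (m ℕ.+ n) h ≈
    binomialSum m λ i j → binomialSum n λ i′ j′ → h (i ℕ.+ i′) (j ℕ.+ j′)
  binomialSum-+ zero    n h = refl
  binomialSum-+ (suc m) n h = +-cong (binomialSum-+ m n _) (binomialSum-+ m n _)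

  binomialSum-*ˡ : ∀ n x h → binomialSum n (λ i j → x * h i j) ≈ x * binomialSum n h
  binomialSum-*ˡ zero    x h = refl
  binomialSum-*ˡ (suc n) x h =
    trans (+-cong (binomialSum-*ˡ n x _) (binomialSum-*ˡ n x _)) (sym (distribˡ x _ _))

  binomialSum-*ʳ : ∀ n x h → binomialSum n (λ i j → h i j * x) ≈ binomialSum n h * x
  binomialSum-*ʳ n x h = begin
    binomialSum n (λ i j → h i j * x)  ≈⟨ binomialSum-cong n (λ i j _ → *-comm _ x) ⟩
    binomialSum n (λ i j → x * h i j)  ≈⟨ binomialSum-*ˡ n x h ⟩
    x * binomialSum n h                ≈⟨ *-comm x _ ⟩
    binomialSum n h * x                ∎

  binomialTheorem : ∀ n x y → binomialSum n (λ i j → x ^ᴿ i * y ^ᴿ j) ≈ (x + y) ^ᴿ n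
  binomialTheorem zero    x y = *-identityˡ 1#
  binomialTheorem (suc n) x y = begin
    binomialSum n (λ i j → (x * x ^ᴿ i) * y ^ᴿ j) + binomialSum n (λ i j → x ^ᴿ i * (y * y ^ᴿ j))
      ≈⟨ +-cong (binomialSum-cong n λ i j _ → *-assoc x _ _)
                (binomialSum-cong n λ i j _ → x∙yz≈y∙xz _ y _) ⟩
    binomialSum n (λ i j → x * (x ^ᴿ i * y ^ᴿ j)) + binomialSum n (λ i j → y * (x ^ᴿ i * y ^ᴿ j))
      ≈⟨ +-cong (binomialSum-*ˡ n x _) (binomialSum-*ˡ n y _) ⟩
    x * binomialSum n (λ i j → x ^ᴿ i * y ^ᴿ j) + y * binomialSum n (λ i j → x ^ᴿ i * y ^ᴿ j)
      ≈⟨ distribʳ _ x y ⟨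
    (x + y) * binomialSum n (λ i j → x ^ᴿ i * y ^ᴿ j)
      ≈⟨ *-congˡ (binomialTheorem n x y) ⟩
    (x + y) ^ᴿ suc n  ∎

  sum-last : ∀ n (f : ℕ → Carrier) →
             sum {suc n} (f ∘ toℕ) ≈ sum {n} (f ∘ toℕ) + f n
  sum-last zero    f = +-comm (f 0) 0#
  sum-last (suc n) f = trans (+-congˡ (sum-last n (f ∘ suc))) (sym (+-assoc _ _ _))

  -- Connects the recursive form, suited to induction, with the explicit coefficients of `mulSeries`
  -- and of the Binomial Theorem.
  binomialSum≈sum : ∀ n h →
    binomialSum n h ≈ sum {suc n} λ i → (n C toℕ i) × h (toℕ i) (n ∸ toℕ i)
  binomialSum≈sum zero h = begin
    h 0 0              ≈⟨ +-identityʳ _ ⟨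
    h 0 0 + 0#         ≈⟨ +-identityʳ _ ⟨
    h 0 0 + 0# + 0#    ∎
  binomialSum≈sum (suc n) h = begin
    binomialSum n (λ i j → h (suc i) j) + binomialSum n (λ i j → h i (suc j))
      ≈⟨ +-cong (binomialSum≈sum n _) (binomialSum≈sum n _) ⟩
    sum {suc n} (left ∘ toℕ) + sum {suc n} (λ i → (n C toℕ i) × h (toℕ i) (suc (n ∸ toℕ i)))
      ≈⟨ +-congˡ upper ⟩
    sum {suc n} (left ∘ toℕ) + (term 0 + sum {suc n} (term ∘ suc ∘ toℕ))
      ≈⟨ x∙yz≈y∙xz₊ _ _ _ ⟩
    term 0 + (sum {suc n} (left ∘ toℕ) + sum {suc n} (term ∘ suc ∘ toℕ))
      ≈⟨ +-cong (×-congˡ (≡.trans (nC0≡1 n) (≡.sym (nC0≡1 (suc n)))))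
                (sym (∑-distrib-+ {suc n} (left ∘ toℕ) (term ∘ suc ∘ toℕ))) ⟩
    (suc n C 0) × h 0 (suc n) + sum {suc n} (λ i → left (toℕ i) + term (suc (toℕ i)))
      ≈⟨ +-congˡ (sum-cong-≋ {suc n} λ i → pascal (toℕ i)) ⟩
    (suc n C 0) × h 0 (suc n) +
    sum {suc n} (λ i → (suc n C suc (toℕ i)) × h (suc (toℕ i)) (n ∸ toℕ i))  ∎
    where
    open import Algebra.Properties.CommutativeSemigroup +-commutativeSemigroup
      using () renaming (x∙yz≈y∙xz to x∙yz≈y∙xz₊)

    term : ℕ → Carrier
    term i = (n C i) × h i (suc n ∸ i)

    left : ℕ → Carrier
    left i = (n C i) × h (suc i) (n ∸ i)

    pascal : ∀ i → left i + term (suc i) ≈ (suc n C suc i) × h (suc i) (n ∸ i)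
    pascal i = trans (sym (×-homo-+ _ (n C i) (n C suc i))) (×-congˡ (nCk+nC[k+1]≡[n+1]C[k+1] n i))

    upper : sum {suc n} (λ i → (n C toℕ i) × h (toℕ i) (suc (n ∸ toℕ i))) ≈
            sum {suc (suc n)} (term ∘ toℕ)
    upper = begin
      sum {suc n} (λ i → (n C toℕ i) × h (toℕ i) (suc (n ∸ toℕ i)))
        ≈⟨ sum-cong-≋ {suc n} (λ i → ×-congʳ (n C toℕ i) (reflexive (≡.cong (h (toℕ i))
             (≡.sym (ℕ.+-∸-assoc 1 (Fin.toℕ≤pred[n] i)))))) ⟩
      sum {suc n} (term ∘ toℕ)
        ≈⟨ +-identityʳ _ ⟨
      sum {suc n} (term ∘ toℕ) + 0#
        -- A term with coefficient `n C suc n`, which is 0, is appended. Once `term 0` is split off,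
        -- the sum is then as long as that of `left`, and Pascal's rule applies termwise.
        ≈⟨ +-congˡ (×-congˡ (≡.sym (k>n⇒nCk≡0 (ℕ.n<1+n n)))) ⟩
      sum {suc n} (term ∘ toℕ) + term (suc n)
        ≈⟨ sum-last (suc n) term ⟨
      sum {suc (suc n)} (term ∘ toℕ)  ∎

  -- Leibniz' rule for ∂ᵐ collapses to that of a derivation, where ∂ is the
  -- shift of series; equivalently, all inner binomial coefficients m C i vanish in R.
  Collapses : ℕ → Set _
  Collapses m = ∀ h → binomialSum m h ≈ h m 0 + h 0 m

  -- The `n * m` shifts form `n` blocks of size `m`; by the collapse each block goes as a whole to
  -- one of the two indices.
  binomialSum-* : ∀ {m} → Collapses m → ∀ n h →
    binomialSum (n ℕ.* m) h ≈ binomialSum n λ i j → h (i ℕ.* m) (j ℕ.* m)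
  binomialSum-* {m} col zero    h = refl
  binomialSum-* {m} col (suc n) h = begin
    binomialSum (m ℕ.+ n ℕ.* m) h
      ≈⟨ binomialSum-+ m (n ℕ.* m) h ⟩
    binomialSum m (λ i j → binomialSum (n ℕ.* m) λ i′ j′ → h (i ℕ.+ i′) (j ℕ.+ j′))
      ≈⟨ col _ ⟩
    binomialSum (n ℕ.* m) (λ i j → h (m ℕ.+ i) j) + binomialSum (n ℕ.* m) (λ i j → h i (m ℕ.+ j))
      ≈⟨ +-cong (binomialSum-* col n _) (binomialSum-* col n _) ⟩
    binomialSum (suc n) (λ i j → h (i ℕ.* m) (j ℕ.* m))  ∎

  -- `p ^ suc k` consists of `p` blocks of size `p ^ k`: the blocks collapse by induction, and the
  -- remaining sum over blocks because `p` collapses.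
  collapses-^ : ∀ {p} → Collapses p → ∀ k → Collapses (p ^ k)
  collapses-^ col zero    h = refl
  collapses-^ {p} col (suc k) h = trans (binomialSum-* (collapses-^ col k) p h) (col _)

  ∣⇒×≈0 : ∀ {p m} → p ≈0In R → p ∣ m → ∀ x → m × x ≈ 0#
  ∣⇒×≈0 {p} p×1≈0 (divides d ≡.refl) x = begin
    (d ℕ.* p) × x       ≡⟨ ≡.cong (_× x) (ℕ.*-comm d p) ⟩
    (p ℕ.* d) × x       ≈⟨ ×-assocˡ x p d ⟨
    p × (d × x)         ≈⟨ ×-congʳ p (*-identityˡ _) ⟨
    p × (1# * (d × x))  ≈⟨ ×-assoc-* p 1# _ ⟨
    (p × 1#) * (d × x)  ≈⟨ *-congʳ p×1≈0 ⟩
    0# * (d × x)        ≈⟨ zeroˡ _ ⟩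
    0#                  ∎

  -- In the explicit form every term except the two outermost has a coefficient divisible by `p`.
  collapses-prime : ∀ {p} → Prime p → p ≈0In R → Collapses p
  collapses-prime {zero}  pr _ = contradiction pr (λ ())
  collapses-prime {suc n} pr p×1≈0 h = begin
    binomialSum (suc n) h
      ≈⟨ binomialSum≈sum (suc n) h ⟩
    term 0 + sum {suc n} (term ∘ suc ∘ toℕ)
      ≈⟨ +-congˡ (sum-last n (term ∘ suc)) ⟩
    term 0 + (sum {n} (term ∘ suc ∘ toℕ) + term (suc n))
      ≈⟨ +-congˡ (+-congʳ (trans (sum-cong-≋ {n} inner) (sum-replicate-zero n))) ⟩
    term 0 + (0# + term (suc n))
      ≈⟨ +-cong outer₀ (trans (+-identityˡ _) outer₁) ⟩
    h 0 (suc n) + h (suc n) 0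
      ≈⟨ +-comm _ _ ⟩
    h (suc n) 0 + h 0 (suc n)  ∎
    where
    term : ℕ → Carrier
    term i = (suc n C i) × h i (suc n ∸ i)

    inner : ∀ (i : Fin n) → term (suc (toℕ i)) ≈ 0#
    inner i = ∣⇒×≈0 p×1≈0 (prime∣C pr z<s (s≤s (Fin.toℕ<n i))) _

    outer₀ : term 0 ≈ h 0 (suc n)
    outer₀ = trans (×-congˡ (nC0≡1 (suc n))) (×-homo-1 _)

    outer₁ : term (suc n) ≈ h (suc n) 0
    outer₁ = begin
      (suc n C suc n) × h (suc n) (n ∸ n)  ≈⟨ ×-congˡ (nCn≡1 (suc n)) ⟩
      1 × h (suc n) (n ∸ n)                ≈⟨ ×-homo-1 _ ⟩
      h (suc n) (n ∸ n)                    ≡⟨ ≡.cong (h (suc n)) (ℕ.n∸n≡0 n) ⟩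
      h (suc n) 0                          ∎

  frobenius : ∀ {m} → Collapses m → ∀ x y → (x + y) ^ᴿ m ≈ x ^ᴿ m + y ^ᴿ m
  frobenius {m} col x y = begin
    (x + y) ^ᴿ m                                ≈⟨ binomialTheorem m x y ⟨
    binomialSum m (λ i j → x ^ᴿ i * y ^ᴿ j)     ≈⟨ col _ ⟩
    x ^ᴿ m * 1# + 1# * y ^ᴿ m                   ≈⟨ +-cong (*-identityʳ _) (*-identityˡ _) ⟩
    x ^ᴿ m + y ^ᴿ m                             ∎

  mulSeries-cong : ∀ {a a′ b b′} → (∀ n → a n ≈ a′ n) → (∀ n → b n ≈ b′ n) →
                   ∀ n → mulSeries rawRing a b n ≈ mulSeries rawRing a′ b′ n
  mulSeries-cong a≈ b≈ n = sum-cong-≋ {suc n} λ i →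
    ×-congʳ (n C toℕ i) (*-cong (a≈ (toℕ i)) (b≈ (n ∸ toℕ i)))

  -- The additivity of a `q`-linear polynomial, phrased for its values: all exponents are powers of
  -- `q`, and for these the power map is additive.
  frobenius-sum : ∀ {q} → Collapses q → ∀ m (a : Fin m → Carrier) x y →
    sum (λ n → a n * (x + y) ^ᴿ (q ^ toℕ n)) ≈
    sum (λ n → a n * x ^ᴿ (q ^ toℕ n)) + sum (λ n → a n * y ^ᴿ (q ^ toℕ n))
  frobenius-sum col m a x y = trans
    (sum-cong-≋ {m} λ n → trans (*-congˡ (frobenius (collapses-^ col (toℕ n)) x y)) (distribˡ _ _ _))
    (∑-distrib-+ {m} _ _)

  -- Products of powers along base-`q` digits

  module DigitProducts (q : ℕ) .{{_ : NonZero q}} where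

    digitProduct : ℕ → (ℕ → Carrier) → ℕ → Carrier
    digitProduct N a i = product {N} λ t → a (toℕ t) ^ᴿ digit q i (toℕ t)

    digitProduct-cong : ∀ N {a b} → (∀ t → a t ≈ b t) →
                        ∀ i → digitProduct N a i ≈ digitProduct N b i
    digitProduct-cong N a≈b i =
      product-cong {N} λ t → ^-congˡ (digit q i (toℕ t)) (a≈b (toℕ t))

    digitProduct-suc : ∀ N a {r} m → r < q →
      digitProduct (suc N) a (r ℕ.+ m ℕ.* q) ≈ a 0 ^ᴿ r * digitProduct N (a ∘ suc) m
    digitProduct-suc N a m r<q = reflexive (≡.cong₂ _*_
      (≡.cong (a 0 ^ᴿ_) ([r+mq]%q≡r m q r<q))
      (≡.cong (digitProduct N (a ∘ suc)) ([r+mq]/q≡m m q r<q)))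

    digitProduct-0 : ∀ N a → digitProduct N a 0 ≈ 1#
    digitProduct-0 zero    a = refl
    digitProduct-0 (suc N) a = begin
      digitProduct (suc N) a 0              ≈⟨ digitProduct-suc N a 0 (ℕ.>-nonZero⁻¹ q) ⟩
      1# * digitProduct N (a ∘ suc) 0       ≈⟨ *-identityˡ _ ⟩
      digitProduct N (a ∘ suc) 0            ≈⟨ digitProduct-0 N (a ∘ suc) ⟩
      1#                                    ∎

    -- Below `q ^ N` all digits from position `N` on are 0, so the extra factors are zeroth powers.
    -- Removing the last digit lowers the bound to `q ^ N` from `q ^ suc N`.
    digitProduct-extend : ∀ N k a i → i < q ^ N → digitProduct (N ℕ.+ k) a i ≈ digitProduct N a i
    digitProduct-extend zero k a zero _ = digitProduct-0 k a
    digitProduct-extend zero k a (suc i) (s≤s ())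
    digitProduct-extend (suc N) k a i i< =
      *-congˡ (digitProduct-extend N k (a ∘ suc) (i / q) (m<q^1+N⇒m/q<q^N N i<))

    -- A positive index below `q ^ N` has a nonzero digit among its first `N`, and the factor there
    -- is a positive power of 0. If the last digit is 0, the quotient by `q` is still positive.
    digitProduct-zeros : ∀ N i → 0 < i → i < q ^ N → digitProduct N (λ _ → 0#) i ≈ 0#
    digitProduct-zeros zero (suc i) _ (s≤s ())
    digitProduct-zeros (suc N) i 0<i i< with i % q in eq
    ... | suc r = trans (*-congʳ (zeroˡ _)) (zeroˡ _)
    ... | zero  = trans (*-congˡ (digitProduct-zeros N (i / q) 0<i/q (m<q^1+N⇒m/q<q^N N i<))) (zeroʳ _)
      where
      0<i/q : 0 < i / q
      0<i/q = ℕ.n≢0⇒n>0 λ i/q≡0 → ℕ.<⇒≢ 0<i (≡.sym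
        (≡.trans (m≡m%n+[m/n]*n i q) (≡.cong₂ ℕ._+_ eq (≡.cong (ℕ._* q) i/q≡0))))

    -- The two binomial theorems, for the last digit and for the remaining ones,
    -- combine because the indices i ≤ r < q and multiples of q add without carry.
    digitProduct-+ : Collapses q → ∀ N a b n → n < q ^ N →
      binomialSum n (λ i j → digitProduct N a i * digitProduct N b j) ≈
      digitProduct N (λ t → a t + b t) n
    digitProduct-+ col zero a b zero _ = *-identityˡ 1#
    digitProduct-+ col zero a b (suc n) (s≤s ())
    digitProduct-+ col (suc N) a b n n< = begin
      binomialSum n h
        ≡⟨ ≡.cong (λ k → binomialSum k h) n≡ ⟩
      binomialSum (r ℕ.+ m ℕ.* q) h
        ≈⟨ binomialSum-+ r (m ℕ.* q) h ⟩
      binomialSum r (λ i j → binomialSum (m ℕ.* q) λ i′ j′ → h (i ℕ.+ i′) (j ℕ.+ j′))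
        ≈⟨ binomialSum-cong r (λ i j _ → binomialSum-* col m _) ⟩
      binomialSum r (λ i j → binomialSum m λ i′ j′ → h (i ℕ.+ i′ ℕ.* q) (j ℕ.+ j′ ℕ.* q))
        ≈⟨ binomialSum-cong r (λ i j i+j≡r → binomialSum-cong m λ i′ j′ _ → trans
             (*-cong (digitProduct-suc N a i′ (ℕ.≤-<-trans (i≤r i j i+j≡r) r<q))
                     (digitProduct-suc N b j′ (ℕ.≤-<-trans (j≤r i j i+j≡r) r<q)))
             (interchange _ _ _ _)) ⟩
      binomialSum r (λ i j → binomialSum m λ i′ j′ →
        (a 0 ^ᴿ i * b 0 ^ᴿ j) * (digitProduct N (a ∘ suc) i′ * digitProduct N (b ∘ suc) j′))
        ≈⟨ binomialSum-cong r (λ i j _ → trans (binomialSum-*ˡ m _ _)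
             (*-congˡ (digitProduct-+ col N (a ∘ suc) (b ∘ suc) m (m<q^1+N⇒m/q<q^N N n<)))) ⟩
      binomialSum r (λ i j → (a 0 ^ᴿ i * b 0 ^ᴿ j) * digitProduct N (λ t → a (suc t) + b (suc t)) m)
        ≈⟨ binomialSum-*ʳ r _ _ ⟩
      binomialSum r (λ i j → a 0 ^ᴿ i * b 0 ^ᴿ j) * digitProduct N (λ t → a (suc t) + b (suc t)) m
        ≈⟨ *-congʳ (binomialTheorem r (a 0) (b 0)) ⟩
      digitProduct (suc N) (λ t → a t + b t) n  ∎
      where
      r = n % q
      m = n / q

      h : ℕ → ℕ → Carrier
      h i j = digitProduct (suc N) a i * digitProduct (suc N) b j

      n≡ : n ≡ r ℕ.+ m ℕ.* q
      n≡ = m≡m%n+[m/n]*n n q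

      r<q : r < q
      r<q = m%n<n n q

      i≤r : ∀ i j → i ℕ.+ j ≡ r → i ≤ r
      i≤r i j eq = ≡.subst (i ≤_) eq (ℕ.m≤m+n i j)

      j≤r : ∀ i j → i ℕ.+ j ≡ r → j ≤ r
      j≤r i j eq = ≡.subst (j ≤_) eq (ℕ.m≤n+m j i)

    -- The length `i` is the cut-off of `digitProducts`, so over `F[x]` the two agree
    -- definitionally.
    digitSeries : (ℕ → Carrier) → ℕ → Carrier
    digitSeries a i = digitProduct i a i

    digitSeries-+ : 1 < q → Collapses q → ∀ a b n →
      mulSeries rawRing (digitSeries a) (digitSeries b) n ≈ digitSeries (λ t → a t + b t) n
    digitSeries-+ 1<q col a b n = begin
      mulSeries rawRing (digitSeries a) (digitSeries b) n
        ≈⟨ binomialSum≈sum n (λ i j → digitSeries a i * digitSeries b j) ⟨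
      binomialSum n (λ i j → digitSeries a i * digitSeries b j)
        -- Since `i + j ≡ n`, both products can be lengthened to the common length `n`.
        ≈⟨ binomialSum-cong n (λ i j i+j≡n → *-cong
             (extend a i j i+j≡n) (extend b j i (≡.trans (ℕ.+-comm j i) i+j≡n))) ⟩
      binomialSum n (λ i j → digitProduct n a i * digitProduct n b j)
        ≈⟨ digitProduct-+ col n a b n (n<m^n n 1<q) ⟩
      digitSeries (λ t → a t + b t) n  ∎
      where
      extend : ∀ a i j → i ℕ.+ j ≡ n → digitSeries a i ≈ digitProduct n a i
      extend a i j ≡.refl = sym (digitProduct-extend i j a i (n<m^n i 1<q))

    digitSeries-zeros : 1 < q → ∀ n → oneSeries rawRing n ≈ digitSeries (λ _ → 0#) n
    digitSeries-zeros 1<q zero    = refl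
    digitSeries-zeros 1<q (suc n) = sym (digitProduct-zeros (suc n) (suc n) z<s (n<m^n (suc n) 1<q))

-- Homomorphisms, and the commutative ring of polynomials

IsSemiringHom : (R : CommutativeRing c ℓ) (S : CommutativeRing c′ ℓ′) →
                (CommutativeRing.Carrier R → CommutativeRing.Carrier S) → Set _
IsSemiringHom R S = SemiringMorphisms.IsSemiringHomomorphism
  (RawRing.rawSemiring (CommutativeRing.rawRing R))
  (RawRing.rawSemiring (CommutativeRing.rawRing S))

module Polynomials (R : CommutativeRing c ℓ) where
  open CommutativeRing R hiding (zero)
  open import Algebra.Properties.Ring ring using (-0#≈0#)
  open import Algebra.Properties.CommutativeSemigroup +-commutativeSemigroup
    using (interchange)
  open SetoidReasoning setoid

  private
    infix 9 _!_
    _!_ : List Carrier → ℕ → Carrier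
    _!_ = coeff rawRing

  -- The Cauchy product on coefficient sequences. The ring laws of multiplication are proved here,
  -- free of list lengths, and carried over by `coeff-mulPoly`.
  convolution : (ℕ → Carrier) → (ℕ → Carrier) → ℕ → Carrier
  convolution f g zero    = f 0 * g 0
  convolution f g (suc n) = f 0 * g (suc n) + convolution (f ∘ suc) g n

  convolution-cong : ∀ {f f′ g g′} → (∀ n → f n ≈ f′ n) → (∀ n → g n ≈ g′ n) →
                     ∀ n → convolution f g n ≈ convolution f′ g′ n
  convolution-cong f≈ g≈ zero    = *-cong (f≈ 0) (g≈ 0)
  convolution-cong f≈ g≈ (suc n) =
    +-cong (*-cong (f≈ 0) (g≈ (suc n))) (convolution-cong (f≈ ∘ suc) g≈ n)

  convolution-zeroˡ : ∀ {f} g → (∀ n → f n ≈ 0#) → ∀ n → convolution f g n ≈ 0#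
  convolution-zeroˡ g f≈0 zero    = trans (*-congʳ (f≈0 0)) (zeroˡ _)
  convolution-zeroˡ g f≈0 (suc n) = trans
    (+-cong (trans (*-congʳ (f≈0 0)) (zeroˡ _)) (convolution-zeroˡ g (f≈0 ∘ suc) n))
    (+-identityˡ 0#)

  -- The defining recursion splits off the first coefficient of `f`; commutativity also needs the
  -- one that splits off the first coefficient of `g`.
  convolution-sucʳ : ∀ f g n →
    convolution f g (suc n) ≈ convolution f (g ∘ suc) n + f (suc n) * g 0
  convolution-sucʳ f g zero    = refl
  convolution-sucʳ f g (suc n) =
    trans (+-congˡ (convolution-sucʳ (f ∘ suc) g n)) (sym (+-assoc _ _ _))

  convolution-comm : ∀ f g n → convolution f g n ≈ convolution g f n
  convolution-comm f g zero    = *-comm _ _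
  convolution-comm f g (suc n) = begin
    f 0 * g (suc n) + convolution (f ∘ suc) g n  ≈⟨ +-cong (*-comm _ _) (convolution-comm (f ∘ suc) g n) ⟩
    g (suc n) * f 0 + convolution g (f ∘ suc) n  ≈⟨ +-comm _ _ ⟩
    convolution g (f ∘ suc) n + g (suc n) * f 0  ≈⟨ convolution-sucʳ g f n ⟨
    convolution g f (suc n)                      ∎

  convolution-distribʳ : ∀ h f g n →
    convolution (λ i → f i + g i) h n ≈ convolution f h n + convolution g h n
  convolution-distribʳ h f g zero    = distribʳ _ _ _
  convolution-distribʳ h f g (suc n) = trans
    (+-cong (distribʳ _ _ _) (convolution-distribʳ h (f ∘ suc) (g ∘ suc) n))
    (interchange _ _ _ _)

  convolution-*ˡ : ∀ a f g n → convolution (λ i → a * f i) g n ≈ a * convolution f g n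
  convolution-*ˡ a f g zero    = *-assoc _ _ _
  convolution-*ˡ a f g (suc n) =
    trans (+-cong (*-assoc _ _ _) (convolution-*ˡ a (f ∘ suc) g n)) (sym (distribˡ _ _ _))

  convolution-assoc : ∀ f g h n →
    convolution (convolution f g) h n ≈ convolution f (convolution g h) n
  convolution-assoc f g h zero    = *-assoc _ _ _
  convolution-assoc f g h (suc n) = begin
    (f 0 * g 0) * h (suc n) +
    convolution (λ i → f 0 * g (suc i) + convolution (f ∘ suc) g i) h n
      ≈⟨ +-cong (*-assoc _ _ _) (convolution-distribʳ h _ _ n) ⟩
    f 0 * (g 0 * h (suc n)) +
    (convolution (λ i → f 0 * g (suc i)) h n + convolution (convolution (f ∘ suc) g) h n)
      ≈⟨ +-congˡ (+-cong (convolution-*ˡ (f 0) (g ∘ suc) h n) (convolution-assoc (f ∘ suc) g h n)) ⟩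
    f 0 * (g 0 * h (suc n)) +
    (f 0 * convolution (g ∘ suc) h n + convolution (f ∘ suc) (convolution g h) n)
      ≈⟨ +-assoc _ _ _ ⟨
    (f 0 * (g 0 * h (suc n)) + f 0 * convolution (g ∘ suc) h n) +
    convolution (f ∘ suc) (convolution g h) n
      ≈⟨ +-congʳ (distribˡ _ _ _) ⟨
    convolution f (convolution g h) (suc n)  ∎

  -- The condition on `φ` serves the positions beyond the end of the list, where `coeff` defaults to
  -- `0#`.
  coeff-map : ∀ {φ : Carrier → Carrier} → φ 0# ≈ 0# → ∀ f n → map φ f ! n ≈ φ (f ! n)
  coeff-map φ0≈0 []      n       = sym φ0≈0
  coeff-map φ0≈0 (a ∷ f) zero    = refl
  coeff-map φ0≈0 (a ∷ f) (suc n) = coeff-map φ0≈0 f n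

  coeff-addPoly : ∀ f g n → addPoly rawRing f g ! n ≈ f ! n + g ! n
  coeff-addPoly []      g       n       = sym (+-identityˡ _)
  coeff-addPoly (a ∷ f) []      n       = sym (+-identityʳ _)
  coeff-addPoly (a ∷ f) (b ∷ g) zero    = refl
  coeff-addPoly (a ∷ f) (b ∷ g) (suc n) = coeff-addPoly f g n

  coeff-mulPoly : ∀ f g n → mulPoly rawRing f g ! n ≈ convolution (f !_) (g !_) n
  coeff-mulPoly [] g n = sym (convolution-zeroˡ (g !_) (λ _ → refl) n)
  coeff-mulPoly (a ∷ f) g zero = begin
    addPoly rawRing (map (a *_) g) (0# ∷ mulPoly rawRing f g) ! 0
      ≈⟨ coeff-addPoly (map (a *_) g) _ 0 ⟩
    map (a *_) g ! 0 + 0#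
      ≈⟨ +-identityʳ _ ⟩
    map (a *_) g ! 0
      ≈⟨ coeff-map (zeroʳ a) g 0 ⟩
    a * g ! 0  ∎
  coeff-mulPoly (a ∷ f) g (suc n) = begin
    addPoly rawRing (map (a *_) g) (0# ∷ mulPoly rawRing f g) ! suc n
      ≈⟨ coeff-addPoly (map (a *_) g) _ (suc n) ⟩
    map (a *_) g ! suc n + mulPoly rawRing f g ! n
      ≈⟨ +-cong (coeff-map (zeroʳ a) g (suc n)) (coeff-mulPoly f g n) ⟩
    a * g ! suc n + convolution (f !_) (g !_) n  ∎

  private
    module P = RawRing (polynomialRing rawRing)

  mulPoly-comm : ∀ f g → f P.* g P.≈ g P.* f
  mulPoly-comm f g n = begin
    (f P.* g) ! n                    ≈⟨ coeff-mulPoly f g n ⟩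
    convolution (f !_) (g !_) n      ≈⟨ convolution-comm (f !_) (g !_) n ⟩
    convolution (g !_) (f !_) n      ≈⟨ coeff-mulPoly g f n ⟨
    (g P.* f) ! n                    ∎

  mulPoly-assoc : ∀ f g h → (f P.* g) P.* h P.≈ f P.* (g P.* h)
  mulPoly-assoc f g h n = begin
    ((f P.* g) P.* h) ! n
      ≈⟨ coeff-mulPoly (f P.* g) h n ⟩
    convolution ((f P.* g) !_) (h !_) n
      ≈⟨ convolution-cong (coeff-mulPoly f g) (λ _ → refl) n ⟩
    convolution (convolution (f !_) (g !_)) (h !_) n
      ≈⟨ convolution-assoc (f !_) (g !_) (h !_) n ⟩
    convolution (f !_) (convolution (g !_) (h !_)) n
      ≈⟨ convolution-cong (λ _ → refl) (coeff-mulPoly g h) n ⟨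
    convolution (f !_) ((g P.* h) !_) n
      ≈⟨ coeff-mulPoly f (g P.* h) n ⟨
    (f P.* (g P.* h)) ! n  ∎

  mulPoly-cong : ∀ {f f′ g g′} → f P.≈ f′ → g P.≈ g′ → f P.* g P.≈ f′ P.* g′
  mulPoly-cong {f} {f′} {g} {g′} f≈ g≈ n = begin
    (f P.* g) ! n                  ≈⟨ coeff-mulPoly f g n ⟩
    convolution (f !_) (g !_) n    ≈⟨ convolution-cong f≈ g≈ n ⟩
    convolution (f′ !_) (g′ !_) n  ≈⟨ coeff-mulPoly f′ g′ n ⟨
    (f′ P.* g′) ! n                ∎

  mulPoly-identityˡ : ∀ f → P.1# P.* f P.≈ f
  mulPoly-identityˡ f n = trans (coeff-mulPoly P.1# f n) (identity n)
    where
    identity : ∀ n → convolution (P.1# !_) (f !_) n ≈ f ! n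
    identity zero    = *-identityˡ _
    identity (suc n) = trans
      (+-cong (*-identityˡ _) (convolution-zeroˡ (f !_) (λ _ → refl) n)) (+-identityʳ _)

  mulPoly-distribʳ : ∀ h f g → (f P.+ g) P.* h P.≈ (f P.* h) P.+ (g P.* h)
  mulPoly-distribʳ h f g n = begin
    ((f P.+ g) P.* h) ! n
      ≈⟨ coeff-mulPoly (f P.+ g) h n ⟩
    convolution ((f P.+ g) !_) (h !_) n
      ≈⟨ convolution-cong (coeff-addPoly f g) (λ _ → refl) n ⟩
    convolution (λ i → f ! i + g ! i) (h !_) n
      ≈⟨ convolution-distribʳ (h !_) (f !_) (g !_) n ⟩
    convolution (f !_) (h !_) n + convolution (g !_) (h !_) n
      ≈⟨ +-cong (coeff-mulPoly f h n) (coeff-mulPoly g h n) ⟨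
    (f P.* h) ! n + (g P.* h) ! n
      ≈⟨ coeff-addPoly (f P.* h) (g P.* h) n ⟨
    ((f P.* h) P.+ (g P.* h)) ! n  ∎

  addPoly-cong : ∀ {f f′ g g′} → f P.≈ f′ → g P.≈ g′ → f P.+ g P.≈ f′ P.+ g′
  addPoly-cong {f} {f′} {g} {g′} f≈ g≈ n = begin
    (f P.+ g) ! n     ≈⟨ coeff-addPoly f g n ⟩
    f ! n + g ! n     ≈⟨ +-cong (f≈ n) (g≈ n) ⟩
    f′ ! n + g′ ! n   ≈⟨ coeff-addPoly f′ g′ n ⟨
    (f′ P.+ g′) ! n   ∎

  addPoly-assoc : ∀ f g h → (f P.+ g) P.+ h P.≈ f P.+ (g P.+ h)
  addPoly-assoc f g h n = begin
    ((f P.+ g) P.+ h) ! n      ≈⟨ coeff-addPoly (f P.+ g) h n ⟩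
    (f P.+ g) ! n + h ! n      ≈⟨ +-congʳ (coeff-addPoly f g n) ⟩
    (f ! n + g ! n) + h ! n    ≈⟨ +-assoc _ _ _ ⟩
    f ! n + (g ! n + h ! n)    ≈⟨ +-congˡ (coeff-addPoly g h n) ⟨
    f ! n + (g P.+ h) ! n      ≈⟨ coeff-addPoly f (g P.+ h) n ⟨
    (f P.+ (g P.+ h)) ! n      ∎

  addPoly-comm : ∀ f g → f P.+ g P.≈ g P.+ f
  addPoly-comm f g n = begin
    (f P.+ g) ! n    ≈⟨ coeff-addPoly f g n ⟩
    f ! n + g ! n    ≈⟨ +-comm _ _ ⟩
    g ! n + f ! n    ≈⟨ coeff-addPoly g f n ⟨
    (g P.+ f) ! n    ∎

  addPoly-identityʳ : ∀ f → f P.+ P.0# P.≈ f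
  addPoly-identityʳ f n = trans (coeff-addPoly f [] n) (+-identityʳ _)

  addPoly-inverseʳ : ∀ f → f P.+ (P.- f) P.≈ P.0#
  addPoly-inverseʳ f n = begin
    (f P.+ (P.- f)) ! n       ≈⟨ coeff-addPoly f (P.- f) n ⟩
    f ! n + (P.- f) ! n       ≈⟨ +-congˡ (coeff-map -0#≈0# f n) ⟩
    f ! n + (- (f ! n))       ≈⟨ -‿inverseʳ _ ⟩
    0#                        ∎

  polynomialCommutativeRing : CommutativeRing c ℓ
  polynomialCommutativeRing = record
    { Carrier = P.Carrier
    ; _≈_     = P._≈_
    ; _+_     = P._+_
    ; _*_     = P._*_
    ; -_      = P.-_
    ; 0#      = P.0#
    ; 1#      = P.1#
    ; isCommutativeRing = record
      { isRing = record
        { +-isAbelianGroup = record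
          { isGroup = record
            { isMonoid = record
              { isSemigroup = record
                { isMagma = record
                  { isEquivalence = record
                    { refl  = λ _ → refl
                    ; sym   = λ f≈g n → sym (f≈g n)
                    ; trans = λ f≈g g≈h n → trans (f≈g n) (g≈h n)
                    }
                  ; ∙-cong = λ {f} {f′} {g} {g′} → addPoly-cong {f} {f′} {g} {g′}
                  }
                ; assoc = addPoly-assoc
                }
              ; identity = (λ f n → refl) , addPoly-identityʳ
              }
            ; inverse = (λ f n → trans (addPoly-comm (P.- f) f n) (addPoly-inverseʳ f n))
                      , addPoly-inverseʳ
            ; ⁻¹-cong = λ {f} {g} f≈g n → trans (coeff-map -0#≈0# f n)
                          (trans (-‿cong (f≈g n)) (sym (coeff-map -0#≈0# g n)))
            }
          ; comm = addPoly-comm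
          }
        ; *-cong     = λ {f} {f′} {g} {g′} → mulPoly-cong {f} {f′} {g} {g′}
        ; *-assoc    = mulPoly-assoc
        ; *-identity = mulPoly-identityˡ
                     , λ f n → trans (mulPoly-comm f P.1# n) (mulPoly-identityˡ f n)
        ; distrib    =
            (λ h f g n → trans (mulPoly-comm h (f P.+ g) n)
               (trans (mulPoly-distribʳ h f g n)
                 (addPoly-cong {f P.* h} {h P.* f} {g P.* h} {h P.* g}
                   (mulPoly-comm f h) (mulPoly-comm g h) n)))
          , mulPoly-distribʳ
        }
      ; *-comm = mulPoly-comm
      }
    }

  const-isSemiringHomomorphism :
    IsSemiringHom R polynomialCommutativeRing (const rawRing)
  const-isSemiringHomomorphism = record
    { isNearSemiringHomomorphism = record
      { +-isMonoidHomomorphism = record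
        { isMagmaHomomorphism = record
          { isRelHomomorphism = record { cong = λ { a≈b zero → a≈b ; a≈b (suc n) → refl } }
          ; homo = λ { a b zero → refl ; a b (suc n) → refl }
          }
        ; ε-homo = λ { zero → refl ; (suc n) → refl }
        }
      ; *-homo = λ { a b zero → sym (+-identityʳ _) ; a b (suc n) → refl }
      }
    ; 1#-homo = λ n → refl
    }

-- Transport along homomorphisms, and evaluation of polynomials

module SemiringHomomorphism (R : CommutativeRing c ℓ) (S : CommutativeRing c′ ℓ′)
  {φ : CommutativeRing.Carrier R → CommutativeRing.Carrier S}
  (φ-hom : IsSemiringHom R S φ)
  where
  private
    module R = CommutativeRing R
    module S = CommutativeRing S
  open SemiringMorphisms.IsSemiringHomomorphism φ-hom
  open import Algebra.Definitions.RawSemiring (RawRing.rawSemiring R.rawRing)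
    using () renaming (_×_ to _×ᴿ_; sum to sumᴿ; product to productᴿ; _^_ to _^ᴿ_)
  open import Algebra.Definitions.RawSemiring (RawRing.rawSemiring S.rawRing)
    using () renaming (_×_ to _×ˢ_; sum to sumˢ; product to productˢ; _^_ to _^ˢ_)

  ×-homo : ∀ n x → φ (n ×ᴿ x) S.≈ n ×ˢ φ x
  ×-homo zero    x = 0#-homo
  ×-homo (suc n) x = S.trans (+-homo _ _) (S.+-congˡ (×-homo n x))

  ^-homo : ∀ x n → φ (x ^ᴿ n) S.≈ φ x ^ˢ n
  ^-homo x zero    = 1#-homo
  ^-homo x (suc n) = S.trans (*-homo _ _) (S.*-congˡ (^-homo x n))

  sum-homo : ∀ n f → φ (sumᴿ {n} f) S.≈ sumˢ {n} (φ ∘ f)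
  sum-homo zero    f = 0#-homo
  sum-homo (suc n) f = S.trans (+-homo _ _) (S.+-congˡ (sum-homo n (f ∘ fsuc)))

  product-homo : ∀ n f → φ (productᴿ {n} f) S.≈ productˢ {n} (φ ∘ f)
  product-homo zero    f = 1#-homo
  product-homo (suc n) f = S.trans (*-homo _ _) (S.*-congˡ (product-homo n (f ∘ fsuc)))

  digitProduct-homo : ∀ q .{{_ : NonZero q}} N a i →
    φ (BinomialSums.DigitProducts.digitProduct R q N a i) S.≈
    BinomialSums.DigitProducts.digitProduct S q N (φ ∘ a) i
  digitProduct-homo q N a i = S.trans (product-homo N _)
    (product-cong {N} λ t → ^-homo (a (toℕ t)) (digit q i (toℕ t)))
    where
    open import Algebra.Properties.CommutativeMonoid.Sum S.*-commutativeMonoid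
      using () renaming (sum-cong-≋ to product-cong)

  ≈0In-homo : ∀ n → n ≈0In R → n ≈0In S
  ≈0In-homo n n×1≈0 = begin
    n ×ˢ S.1#        ≈⟨ ×-congʳ n 1#-homo ⟨
    n ×ˢ φ R.1#      ≈⟨ ×-homo n R.1# ⟨
    φ (n ×ᴿ R.1#)    ≈⟨ ⟦⟧-cong n×1≈0 ⟩
    φ R.0#           ≈⟨ 0#-homo ⟩
    S.0#             ∎
    where
    open SetoidReasoning S.setoid
    open import Algebra.Properties.Monoid.Mult S.+-monoid using (×-congʳ)

  module Evaluation (s : S.Carrier) where
    open Polynomials R using (polynomialCommutativeRing)
    open S hiding (zero)
    open SetoidReasoning setoid
    open import Algebra.Properties.CommutativeSemigroup +-commutativeSemigroup using (interchange)
    open import Algebra.Properties.CommutativeSemigroup *-commutativeSemigroup using (x∙yz≈y∙xz)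
    private
      module P = CommutativeRing polynomialCommutativeRing

    -- Horner's scheme. When `φ` embeds `F` into `F[x,y]` as constants, it is definitionally the
    -- substitution `_⟨_⟩`.
    eval : P.Carrier → Carrier
    eval = foldr (λ a r → φ a + s * r) 0#

    eval-zero : ∀ f → f P.≈ P.0# → eval f ≈ 0#
    eval-zero []      _   = refl
    eval-zero (a ∷ f) f≈0 = begin
      φ a + s * eval f  ≈⟨ +-cong (trans (⟦⟧-cong (f≈0 0)) 0#-homo)
                                  (*-congˡ (eval-zero f (f≈0 ∘ suc))) ⟩
      0# + s * 0#       ≈⟨ +-identityˡ _ ⟩
      s * 0#            ≈⟨ zeroʳ s ⟩
      0#                ∎

    -- Equal polynomials may be lists of different lengths; the surplus of the longer one has only
    -- zero coefficients and evaluates to 0.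
    eval-cong : ∀ f g → f P.≈ g → eval f ≈ eval g
    eval-cong []      g       f≈g = sym (eval-zero g λ n → R.sym (f≈g n))
    eval-cong (a ∷ f) []      f≈g = eval-zero (a ∷ f) f≈g
    eval-cong (a ∷ f) (b ∷ g) f≈g =
      +-cong (⟦⟧-cong (f≈g 0)) (*-congˡ (eval-cong f g (f≈g ∘ suc)))

    eval-+ : ∀ f g → eval (f P.+ g) ≈ eval f + eval g
    eval-+ []      g       = sym (+-identityˡ _)
    eval-+ (a ∷ f) []      = sym (+-identityʳ _)
    eval-+ (a ∷ f) (b ∷ g) = begin
      φ (a R.+ b) + s * eval (f P.+ g)
        ≈⟨ +-cong (+-homo a b) (trans (*-congˡ (eval-+ f g)) (distribˡ s _ _)) ⟩
      (φ a + φ b) + (s * eval f + s * eval g)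
        ≈⟨ interchange _ _ _ _ ⟩
      (φ a + s * eval f) + (φ b + s * eval g)  ∎

    eval-map-* : ∀ a f → eval (map (a R.*_) f) ≈ φ a * eval f
    eval-map-* a []      = sym (zeroʳ _)
    eval-map-* a (b ∷ f) = begin
      φ (a R.* b) + s * eval (map (a R.*_) f)  ≈⟨ +-cong (*-homo a b) (*-congˡ (eval-map-* a f)) ⟩
      φ a * φ b + s * (φ a * eval f)           ≈⟨ +-congˡ (x∙yz≈y∙xz s _ _) ⟩
      φ a * φ b + φ a * (s * eval f)           ≈⟨ distribˡ _ _ _ ⟨
      φ a * (φ b + s * eval f)                 ∎

    eval-* : ∀ f g → eval (f P.* g) ≈ eval f * eval g
    eval-* []      g = sym (zeroˡ _)
    eval-* (a ∷ f) g = begin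
      eval (map (a R.*_) g P.+ (R.0# ∷ f P.* g))
        ≈⟨ eval-+ (map (a R.*_) g) _ ⟩
      eval (map (a R.*_) g) + (φ R.0# + s * eval (f P.* g))
        ≈⟨ +-cong (eval-map-* a g) (+-cong 0#-homo (*-congˡ (eval-* f g))) ⟩
      φ a * eval g + (0# + s * (eval f * eval g))
        ≈⟨ +-congˡ (trans (+-identityˡ _) (sym (*-assoc s _ _))) ⟩
      φ a * eval g + (s * eval f) * eval g
        ≈⟨ distribʳ _ _ _ ⟨
      (φ a + s * eval f) * eval g  ∎

    eval-const : ∀ a → eval (const R.rawRing a) ≈ φ a
    eval-const a = trans (+-congˡ (zeroʳ s)) (+-identityʳ _)

    eval-X : eval (X R.rawRing) ≈ s
    eval-X = begin
      φ R.0# + s * (φ R.1# + s * 0#)  ≈⟨ +-cong 0#-homo (*-congˡ (trans (eval-const R.1#) 1#-homo)) ⟩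
      0# + s * 1#                     ≈⟨ +-identityˡ _ ⟩
      s * 1#                          ≈⟨ *-identityʳ s ⟩
      s                               ∎

    eval-isSemiringHomomorphism : IsSemiringHom polynomialCommutativeRing S eval
    eval-isSemiringHomomorphism = record
      { isNearSemiringHomomorphism = record
        { +-isMonoidHomomorphism = record
          { isMagmaHomomorphism = record
            { isRelHomomorphism = record { cong = λ {f} {g} → eval-cong f g }
            ; homo = eval-+
            }
          ; ε-homo = refl
          }
        ; *-homo = eval-*
        }
      ; 1#-homo = trans (eval-const R.1#) 1#-homo
      }

  -- The two sums may differ in length: coefficients are added where both exist, and the tail of the
  -- longer sum is kept. The weights `w` are arbitrary so that the induction can pass to `w ∘ suc`.
  sumOfMultiples-+ : ∀ m n (a : Fin m → R.Carrier) (b : Fin n → R.Carrier) (w : ℕ → S.Carrier) →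
    ∃[ l ] Σ (Fin l → R.Carrier) λ d →
      sumˢ (λ i → φ (a i) S.* w (toℕ i)) S.+ sumˢ (λ i → φ (b i) S.* w (toℕ i)) S.≈
      sumˢ (λ i → φ (d i) S.* w (toℕ i))
  sumOfMultiples-+ zero    n       a b w = n , b , S.+-identityˡ _
  sumOfMultiples-+ (suc m) zero    a b w = suc m , a , S.+-identityʳ _
  sumOfMultiples-+ (suc m) (suc n) a b w
    with l , d , eq ← sumOfMultiples-+ m n (a ∘ fsuc) (b ∘ fsuc) (w ∘ suc)
    = suc l , (a fzero R.+ b fzero) ∷ᵛ d , (begin
      (φ (a fzero) S.* w 0 S.+ A) S.+ (φ (b fzero) S.* w 0 S.+ B)
        ≈⟨ interchange _ _ _ _ ⟩
      (φ (a fzero) S.* w 0 S.+ φ (b fzero) S.* w 0) S.+ (A S.+ B)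
        ≈⟨ S.+-cong (S.sym (S.distribʳ _ _ _)) eq ⟩
      (φ (a fzero) S.+ φ (b fzero)) S.* w 0 S.+ _
        ≈⟨ S.+-congʳ (S.*-congʳ (+-homo _ _)) ⟨
      φ (a fzero R.+ b fzero) S.* w 0 S.+ _  ∎)
    where
    open SetoidReasoning S.setoid
    open import Algebra.Properties.CommutativeSemigroup S.+-commutativeSemigroup using (interchange)
    A = sumˢ (λ i → φ (a (fsuc i)) S.* w (suc (toℕ i)))
    B = sumˢ (λ i → φ (b (fsuc i)) S.* w (suc (toℕ i)))

-- `q`-linear polynomials and the additivity of their values

module LinearPolynomials (R : CommutativeRing c ℓ) where
  private
    module R = CommutativeRing R
  open Polynomials R
  module P = CommutativeRing polynomialCommutativeRing
  open import Algebra.Definitions.RawSemiring (RawRing.rawSemiring P.rawRing)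
    using () renaming (sum to sumᴾ; _^_ to _^ᴾ_)

  linearPolynomial : ℕ → ∀ {m} → (Fin m → R.Carrier) → P.Carrier
  linearPolynomial q a = sumᴾ λ n → const R.rawRing (a n) P.* X R.rawRing ^ᴾ (q ^ toℕ n)

  -- Over `F` this unfolds to `IsLinear`.
  Linear : ℕ → P.Carrier → Set _
  Linear q f = ∃[ m ] Σ (Fin m → R.Carrier) λ a → f P.≈ linearPolynomial q a

  zero-linear : ∀ q → Linear q P.0#
  zero-linear q = 0 , (λ ()) , λ n → R.refl

  +-linear : ∀ {q f g} → Linear q f → Linear q g → Linear q (f P.+ g)
  +-linear {q} {f} {g} (m , a , f≈) (n , b , g≈)
    with l , d , eq ← SemiringHomomorphism.sumOfMultiples-+ R polynomialCommutativeRing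
                        const-isSemiringHomomorphism m n a b (λ n → X R.rawRing ^ᴾ (q ^ n))
    = l , d , λ i → R.trans (addPoly-cong
        {f} {linearPolynomial q a} {g} {linearPolynomial q b} f≈ g≈ i) (eq i)

  module _ (S : CommutativeRing c′ ℓ′) {φ} (φ-hom : IsSemiringHom R S φ) where
    open CommutativeRing S hiding (zero)
    open SetoidReasoning setoid
    open SemiringHomomorphism R S φ-hom
    open BinomialSums S using (Collapses; frobenius-sum; mulSeries-cong; module DigitProducts)
    open import Algebra.Properties.CommutativeMonoid.Sum +-commutativeMonoid using (sum; sum-cong-≋)
    open import Algebra.Properties.Semiring.Exp semiring using (^-congˡ) renaming (_^_ to _^ˢ_)

    eval-linear : ∀ q {m} (a : Fin m → R.Carrier) f → f P.≈ linearPolynomial q a →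
      ∀ s → Evaluation.eval s f ≈ sum λ n → φ (a n) * s ^ˢ (q ^ toℕ n)
    eval-linear q {m} a f f≈ s = begin
      eval f
        ≈⟨ eval-cong f (linearPolynomial q a) f≈ ⟩
      eval (linearPolynomial q a)
        ≈⟨ Eval.sum-homo m _ ⟩
      sum (λ n → eval (const R.rawRing (a n) P.* X R.rawRing ^ᴾ (q ^ toℕ n)))
        ≈⟨ sum-cong-≋ {m} (λ n → trans
             (eval-* (const R.rawRing (a n)) (X R.rawRing ^ᴾ (q ^ toℕ n)))
             (*-cong (eval-const (a n)) (trans
               (Eval.^-homo (X R.rawRing) (q ^ toℕ n)) (^-congˡ (q ^ toℕ n) eval-X)))) ⟩
      sum (λ n → φ (a n) * s ^ˢ (q ^ toℕ n))  ∎
      where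
      open Evaluation s
      module Eval = SemiringHomomorphism polynomialCommutativeRing S eval-isSemiringHomomorphism

    eval-additive : ∀ {q} → Collapses q → ∀ {f} → Linear q f → ∀ s t →
      Evaluation.eval (s + t) f ≈ Evaluation.eval s f + Evaluation.eval t f
    eval-additive {q} col {f} (m , a , f≈) s t = begin
      Evaluation.eval (s + t) f
        ≈⟨ eval-linear q a f f≈ (s + t) ⟩
      sum (λ n → φ (a n) * (s + t) ^ˢ (q ^ toℕ n))
        ≈⟨ frobenius-sum col m (φ ∘ a) s t ⟩
      sum (λ n → φ (a n) * s ^ˢ (q ^ toℕ n)) + sum (λ n → φ (a n) * t ^ˢ (q ^ toℕ n))
        ≈⟨ +-cong (eval-linear q a f f≈ s) (eval-linear q a f f≈ t) ⟨
      Evaluation.eval s f + Evaluation.eval t f  ∎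

    -- Evaluation at a point is a homomorphism and hence passes inside products of powers. What
    -- remains is the additivity of each `e u` and `digitSeries-+` in `S`.
    eval-digitSeries-+ : ∀ q .{{_ : NonZero q}} → 1 < q → Collapses q →
      ∀ {e} → (∀ t → Linear q (e t)) → ∀ s t n →
      let p = BinomialSums.DigitProducts.digitSeries polynomialCommutativeRing q e in
      Evaluation.eval (s + t) (p n) ≈
      mulSeries rawRing (λ i → Evaluation.eval s (p i)) (λ i → Evaluation.eval t (p i)) n
    eval-digitSeries-+ q 1<q col {e} e-linear s t n = begin
      Evaluation.eval (s + t) (p n)
        ≈⟨ eval-digitSeries (s + t) n ⟩
      digitSeries (Evaluation.eval (s + t) ∘ e) n
        ≈⟨ digitProduct-cong n (λ u → eval-additive col {e u} (e-linear u) s t) n ⟩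
      digitSeries (λ u → Evaluation.eval s (e u) + Evaluation.eval t (e u)) n
        ≈⟨ digitSeries-+ 1<q col (Evaluation.eval s ∘ e) (Evaluation.eval t ∘ e) n ⟨
      mulSeries rawRing (digitSeries (Evaluation.eval s ∘ e)) (digitSeries (Evaluation.eval t ∘ e)) n
        ≈⟨ mulSeries-cong (eval-digitSeries s) (eval-digitSeries t) n ⟨
      mulSeries rawRing (λ i → Evaluation.eval s (p i)) (λ i → Evaluation.eval t (p i)) n  ∎
      where
      open DigitProducts q
      p = BinomialSums.DigitProducts.digitSeries polynomialCommutativeRing q e

      eval-digitSeries : ∀ s i → Evaluation.eval s (p i) ≈ digitSeries (Evaluation.eval s ∘ e) i
      eval-digitSeries s i = SemiringHomomorphism.digitProduct-homo polynomialCommutativeRing S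
        (Evaluation.eval-isSemiringHomomorphism s) q i e i

-- The characteristic of a field with a finite subfield

module _ (R : CommutativeRing c ℓ) where
  open CommutativeRing R hiding (zero)
  open import Algebra.Properties.CommutativeMonoid.Sum +-commutativeMonoid
  open import Algebra.Properties.Semiring.Mult semiring
  open import Algebra.Properties.Semiring.Exp semiring using () renaming (_^_ to _^ᴿ_)
  open import Algebra.Properties.Group +-group using (identityʳ-unique)
  open SetoidReasoning setoid

  ×1-^ : ∀ m n → (m ^ n) × 1# ≈ (m × 1#) ^ᴿ n
  ×1-^ m zero    = +-identityʳ 1#
  ×1-^ m (suc n) = trans (×1-homo-* m (m ^ n)) (*-congˡ (×1-^ m n))

  -- Translation by x permutes the ring, so the sum of all elements is
  -- unchanged when n × x is added to it.
  order×≈0 : ∀ {n} → Inverse setoid (≡.setoid (Fin n)) → ∀ x → n × x ≈ 0#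
  order×≈0 {n} enum x = identityʳ-unique (sum from) (n × x) $ begin
    sum from + n × x                    ≈⟨ +-congˡ (sum-replicate n) ⟨
    sum from + sum {n} (λ _ → x)        ≈⟨ ∑-distrib-+ from (λ _ → x) ⟨
    sum (λ i → from i + x)              ≈⟨ sum-cong-≋ {n} (λ i → strictlyInverseʳ (from i + x)) ⟨
    sum (λ i → from (to (from i + x)))  ≈⟨ sum-permute from translation ⟨
    sum from                            ∎
    where
    open Inverse enum

    -- Stated for a pair of opposite elements so that it yields both inverse laws of `translation`.
    shift-cancel : ∀ y z → y + z ≈ 0# → ∀ i → to (from (to (from i + y)) + z) ≡ i
    shift-cancel y z y+z≈0 i = ≡.trans
      (to-cong (begin
        from (to (from i + y)) + z  ≈⟨ +-congʳ (strictlyInverseʳ (from i + y)) ⟩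
        (from i + y) + z            ≈⟨ +-assoc _ _ _ ⟩
        from i + (y + z)            ≈⟨ +-congˡ y+z≈0 ⟩
        from i + 0#                 ≈⟨ +-identityʳ _ ⟩
        from i                      ∎))
      (strictlyInverseˡ i)

    translation : Permutation n n
    translation = permutation (λ i → to (from i + x)) (λ i → to (from i - x))
      (shift-cancel (- x) x (-‿inverseˡ x)) (shift-cancel x (- x) (-‿inverseʳ x))

module _ (K : HeytingField c ℓ₁ ℓ₂) where
  open HeytingField K hiding (zero)
  open import Algebra.Apartness.Properties.HeytingCommutativeRing heytingCommutativeRing
  open import Algebra.Definitions.RawSemiring (RawRing.rawSemiring (fieldRawRing K))
    using () renaming (_^_ to _^ᴿ_)

  1≉0 : ¬ 1# ≈ 0#
  1≉0 1≈0 = proj₂ (tight 1# 0#) 1≈0 1#0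

  -- Contrapositive through apartness: elements apart from 0 are closed under products, and
  -- tightness turns the negation of apartness into equality.
  ^≈0⇒≈0 : ∀ {x} n → x ^ᴿ n ≈ 0# → x ≈ 0#
  ^≈0⇒≈0 {x} n xⁿ≈0 = proj₁ (tight x 0#) λ x#0 → proj₂ (tight _ 0#) xⁿ≈0 (^#0 x#0 n)
    where
    ^#0 : x # 0# → ∀ n → x ^ᴿ n # 0#
    ^#0 x#0 zero    = 1#0
    ^#0 x#0 (suc n) = x#0y#0→xy#0 x#0 (^#0 x#0 n)

fieldRing : HeytingField c ℓ₁ ℓ₂ → CommutativeRing c ℓ₁
fieldRing K = HeytingCommutativeRing.commutativeRing (HeytingField.heytingCommutativeRing K)

-- The order `p ^ k` annihilates 1 in the subfield, hence in `F`. There `p ^ k` times 1 is the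
-- `k`-th power of `p` times 1, and a field has no nonzero nilpotents.
characteristic : ∀ p k {q} → q ≡ p ^ k →
  (F : HeytingField c ℓ₁ ℓ₂) (𝔽q : HeytingField c′ ℓ₁′ ℓ₂′) → HasOrder 𝔽q q →
  ∀ {ι} → IsSemiringHom (fieldRing 𝔽q) (fieldRing F) ι →
  p ≈0In fieldRing F
characteristic p k ≡.refl F 𝔽q order ι-hom = ^≈0⇒≈0 F k
  (R.trans (R.sym (×1-^ R p k))
    (SemiringHomomorphism.≈0In-homo (fieldRing 𝔽q) R ι-hom (p ^ k) (order×≈0 (fieldRing 𝔽q) order _)))
  where
  R = fieldRing F
  module R = CommutativeRing R

-- The subspace property

corollary2 : ∀ {c ℓ₁ ℓ₂ c′ ℓ₁′ ℓ₂′ : Level} (p k q : ℕ) .{{_ : NonZero q}} →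
    Prime p → 1 ≤ k → q ≡ p ^ k →
    (F : HeytingField c ℓ₁ ℓ₂) →
    (𝔽q : HeytingField c′ ℓ₁′ ℓ₂′) → HasOrder 𝔽q q →
    (ι : HeytingField.Carrier 𝔽q → HeytingField.Carrier F) →
    RingMorphisms.IsRingMonomorphism (fieldRawRing 𝔽q) (fieldRawRing F) ι →
    IsSubspace F p (𝔅𝔇*₀ F q) (𝔅𝔇* F)
corollary2 p k q p-prime 1≤k q≡p^k F 𝔽q order ι ι-mono = record
  { W⊆V         = λ { (e , e∈𝔏 , f≈) →
      -- With evaluation points `varX F` and `varY F` in `F[x,y]`, both sides unfold to those of the
      -- Binomial Theorem for `D e`.
      D e , eval-digitSeries-+ P² scalar-hom q 1<q (collapses P² p≈0In-P²) {e} e∈𝔏 (varX F) (varY F)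
          -- The term of index 0 is the empty product, whose constant coefficient is 1.
          , (λ D≈0 → 1≉0 F (D≈0 0 0))
          , f≈ }
  ; zero-closed = 1∈W
  ; add-closed  = λ {f} {g} → *∈W {f} {g}
  ; smul-closed = λ n {f} → ^∈W (toℕ n) {f}
  }
  where
  R = fieldRing F
  open Polynomials R using () renaming
    (polynomialCommutativeRing to P; const-isSemiringHomomorphism to R→P)
  open Polynomials P using () renaming
    (polynomialCommutativeRing to P²; const-isSemiringHomomorphism to P→P²)
  open LinearPolynomials R using (zero-linear; +-linear; eval-digitSeries-+)
  module R = CommutativeRing R
  module P² = CommutativeRing P²
  module S = RawRing (F[x]⟪𝔇⟫ F)
  open BinomialSums P using (mulSeries-cong; module DigitProducts)
  open DigitProducts q using (digitSeries-+; digitSeries-zeros)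
  open import Algebra.Definitions.RawSemiring S.rawSemiring using () renaming (_^_ to _^ˢ_)

  D : (ℕ → RawRing.Carrier (F[x] F)) → S.Carrier
  D = digitProducts F q

  scalar-hom : IsSemiringHom R P² _
  scalar-hom = Composition.isSemiringHomomorphism
    (λ {f} {g} {h} → P².trans {f} {g} {h}) R→P P→P²

  p≈0In-R : p ≈0In R
  p≈0In-R = characteristic p k q≡p^k F 𝔽q order
    (RingMorphisms.IsRingMonomorphism.isSemiringHomomorphism ι-mono)

  p≈0In-P : p ≈0In P
  p≈0In-P = SemiringHomomorphism.≈0In-homo R P R→P p p≈0In-R

  p≈0In-P² : p ≈0In P²
  p≈0In-P² = SemiringHomomorphism.≈0In-homo R P² scalar-hom p p≈0In-R

  collapses : ∀ {c ℓ} (S : CommutativeRing c ℓ) → p ≈0In S → BinomialSums.Collapses S q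
  collapses S p≈0 rewrite q≡p^k = collapses-^ (collapses-prime p-prime p≈0) k
    where open BinomialSums S

  1<q : 1 < q
  1<q = ≡.subst (1 <_) (≡.sym q≡p^k)
    -- `1` is `p ^ 0`, and `0 < k`.
    (ℕ.^-monoʳ-< p (ℕ.nonTrivial⇒n>1 p {{prime⇒nonTrivial p-prime}}) 1≤k)

  1∈W : S.1# ∈ 𝔅𝔇*₀ F q
  1∈W = (λ _ → []) , (λ _ → zero-linear q) , digitSeries-zeros 1<q

  *∈W : ∀ {f g} → f ∈ 𝔅𝔇*₀ F q → g ∈ 𝔅𝔇*₀ F q → f S.* g ∈ 𝔅𝔇*₀ F q
  *∈W {f} {g} (e , e∈𝔏 , f≈) (e′ , e′∈𝔏 , g≈) =
    (λ t → addPoly R.rawRing (e t) (e′ t)) , (λ t → +-linear {q} {e t} {e′ t} (e∈𝔏 t) (e′∈𝔏 t)) ,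
    λ n i → R.trans (mulSeries-cong {f} {D e} {g} {D e′} f≈ g≈ n i)
                    (digitSeries-+ 1<q (collapses P p≈0In-P) e e′ n i)

  -- The scalar action is iterated vector addition, so closure under products suffices; the
  -- induction runs over all natural exponents and not only those below `p`.
  ^∈W : ∀ n {f} → f ∈ 𝔅𝔇*₀ F q → f ^ˢ n ∈ 𝔅𝔇*₀ F q
  ^∈W zero    f∈W = 1∈W
  ^∈W (suc n) {f} f∈W = *∈W {f} {f ^ˢ n} f∈W (^∈W n {f} f∈W)
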